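{- Let $r>k\ge 2$ and let $G$ and $F$ be $r$-graphs such that $G$ is not $k$-shadow-homomorphic to $F$. Then there exists a constant $c$ depending only on $F$ such that, for all sufficiently large $n$, $$f_{F,G}(n)\le c(\log n)^{\frac{1}{k-1}}.$$
   Context: An $r$-graph is an $r$-uniform hypergraph. An $r$-graph is $G$-free if it contains no (not necessarily induced) subgraph isomorphic to $G$. For $r$-graphs $F,G$ and $n\ge1$, $f_{F,G}(n)$ is the maximum integer $m$ such that every $n$-vertex $G$-free $r$-graph contains an $F$-free induced subgraph on $m$ vertices. For an $r$-graph $H$, $\partial_k H=\bigcup_{e\in E(H)}\binom{e}{k}$ is its $k$-shadow. An $r$-graph $A$ is $k$-shadow-homomorphic to an $r$-graph $B$ if one can choose for each $S\in\partial_k A$ a set $f(S)\in\partial_k B$ and a bijection $g_S:S\to f(S)$ such that for every edge $e\in E(A)$ there exist an edge $e'\in E(B)$ and a bijection $g:e\to e'$ with $g|_S=g_S$ for every $S\in\binom{e}{k}$. -}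

module Defs where

open import Data.Nat using (ℕ; _≤_; _∸_; _^_; _*_)
open import Data.Fin using (Fin)
open import Data.Fin.Subset using (Subset; _∈_; _⊆_; ∣_∣)
open import Data.Product using (Σ; _×_; _,_)
open import Data.Empty using (⊥)
open import Relation.Binary.PropositionalEquality using (_≡_)
open import Function.Definitions using (Injective)

Hypergraph : ℕ → Set₁
Hypergraph v = Subset v → Set

IsRGraph : ∀ {v} → ℕ → Hypergraph v → Set
IsRGraph r H = ∀ e → H e → ∣ e ∣ ≡ r

IsImage : ∀ {a b} → (Fin a → Fin b) → Subset a → Subset b → Set
IsImage φ e e' = (∀ i → i ∈ e → φ i ∈ e')
               × (∀ j → j ∈ e' → Σ (Fin _) λ i → i ∈ e × φ i ≡ j)

Contains : ∀ {vH vG} → Hypergraph vH → Hypergraph vG → Set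
Contains {vH} {vG} H G = Σ (Fin vG → Fin vH) λ φ →
  Injective _≡_ _≡_ φ ×
  (∀ e → G e → Σ (Subset vH) λ e' → IsImage φ e e' × H e')

Free : ∀ {vG vH} → Hypergraph vG → Hypergraph vH → Set
Free G H = Contains H G → ⊥

-- The induced subgraph of H on the image of an injective map ψ : Fin m → Fin v,
-- with vertices relabelled by Fin m.
Induced : ∀ {v m} → Hypergraph v → (Fin m → Fin v) → Hypergraph m
Induced {v} H ψ e = Σ (Subset v) λ e' → IsImage ψ e e' × H e'

EveryContainsFreeInduced : ∀ {vF vG} → ℕ → Hypergraph vF → Hypergraph vG → ℕ → ℕ → Set₁
EveryContainsFreeInduced r F G n m = (H : Hypergraph n) → IsRGraph r H → Free G H →
  Σ (Fin m → Fin n) λ ψ → Injective _≡_ _≡_ ψ × Free F (Induced H ψ)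

InShadow : ∀ {v} → ℕ → Hypergraph v → Subset v → Set
InShadow k A S = (∣ S ∣ ≡ k) × Σ (Subset _) λ e → A e × S ⊆ e

BijOn : ∀ {a b} → (Fin a → Fin b) → Subset a → Subset b → Set
BijOn h S T = (∀ i → i ∈ S → h i ∈ T)
            × (∀ i j → i ∈ S → j ∈ S → h i ≡ h j → i ≡ j)
            × (∀ t → t ∈ T → Σ (Fin _) λ i → i ∈ S × h i ≡ t)

ShadowHom : ∀ {vA vB} → ℕ → Hypergraph vA → Hypergraph vB → Set
ShadowHom {vA} {vB} k A B =
  Σ ((S : Subset vA) → InShadow k A S → Subset vB) λ f →
  Σ ((S : Subset vA) → InShadow k A S → Fin vA → Fin vB) λ g →
    (∀ S (p : InShadow k A S) → InShadow k B (f S p) × BijOn (g S p) S (f S p))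
  × (∀ e → A e → Σ (Subset vB) λ e' → B e' × Σ (Fin vA → Fin vB) λ h →
        BijOn h e e'
      × (∀ S (p : InShadow k A S) → S ⊆ e → ∀ i → i ∈ S → h i ≡ g S p i))

{-# OPTIONS --safe #-}

-- Write v for the number of vertices of F. Colour all pairs (T , x), with T a k-subset of the
-- n vertices and x ∈ T, by vertices of F, and let e be an edge of H when some bijection from e
-- to an edge of F agrees with the colouring on every k-subset of e. A copy of G in H reads off a
-- k-shadow-homomorphism from G to F, so H is G-free whatever the colouring.
-- It remains to find a colouring for which every m-set contains a copy of F. A fixed embedding of
-- Fin v carries a copy of F as soon as the colouring inverts it on the k-subsets of its image,
-- which has probability at least 1 / D with D independent of n. Integer polynomials of degree
-- < k with coefficients below q ~ m provide q ^ k embeddings into an m-set, any two of which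
-- share no k-subset, since distinct polynomials agree in fewer than k points. These events
-- are independent, so the union bound succeeds as soon as n ^ m (1 - 1 / D) ^ (q ^ k) < 1, which
-- holds when m ^ (k - 1) > C log n.
module Submission where

open import Defs
open import Algebra.Properties.CommutativeMonoid.Sum as Product using ()
open import Algebra.Properties.Semiring.Sum as Sum using ()
open import Data.Bool using (Bool; true; false)
open import Data.Empty using (⊥)
open import Data.Fin using (Fin; zero; suc; _≟_; punchIn; combine; inject≤; toℕ; fromℕ<; funToFin; finToFun)
open import Data.Fin.Properties using (any?; all?; punchInᵢ≢i; suc-injective; combine-injective; inject≤-injective; toℕ<n; toℕ-injective; fromℕ<-injective; funToFin-finToFin; finToFun-funToFin)
open import Data.Fin.Subset using (Subset; ∣_∣; _∈_; _⊆_; _-_; ⊤; inside; outside)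
open import Data.Fin.Subset.Properties using (_∈?_; x∈p∧x≢y⇒x∈p-y; x∈p⇒∣p-x∣<∣p∣; anySubset?; ∣⊤∣≡n; ∈⊤; ⊆-antisym)
open import Data.Integer as ℤ using (ℤ; +_; 0ℤ)
import Data.Integer.Properties as ℤₚ
open import Data.Integer.Tactic.RingSolver using () renaming (solve-∀ to solveℤ-∀)
open import Data.Maybe using (Maybe; just; nothing; is-just)
open import Data.Nat using (ℕ; zero; suc; _+_; _*_; _∸_; _^_; _≤_; _<_; z≤n; s≤s; NonZero; _/_; _%_; >-nonZero; >-nonZero⁻¹)
open import Data.Nat.DivMod using (m≡m%n+[m/n]*n; m%n<n; m/n*n≤m; m≥n⇒m/n>0)
open import Data.Nat.Logarithm using (⌊log₂_⌋; ⌊log₂⌋-mono-≤; ⌊log₂[2^n]⌋≡n)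
open import Data.Nat.Properties as ℕₚ hiding (_≟_; suc-injective)
open import Data.Nat.Tactic.RingSolver using (solve-∀)
open import Data.Product using (Σ; ∃; _×_; _,_; proj₁; proj₂)
open import Data.Sum using (inj₁; inj₂)
open import Data.Unit using (tt) renaming (⊤ to Unit)
open import Data.Vec using (Vec; []; _∷_; tabulate; here; there)
open import Data.Vec.Properties using (lookup∘tabulate; lookup⇒[]=; []=⇒lookup)
open import Data.Vec.Relation.Unary.All using (All; []; _∷_)
open import Function using (_∘_)
open import Function.Definitions using (Injective)
open import Relation.Binary.PropositionalEquality
open import Relation.Nullary using (¬_; Dec; does; yes; no; contradiction)
open import Relation.Nullary.Decidable using (_×-dec_; _→-dec_; dec-true)

open Sum +-*-semiring using (sum; sum-cong-≗; sum-remove; ∑-comm; *-distribˡ-sum; *-distribʳ-sum)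
open Product *-1-commutativeMonoid using () renaming (sum to prod; sum-cong-≗ to prod-cong)

-- Random colourings and disjoint patterns

sum-const : ∀ n c → sum {n} (λ _ → c) ≡ n * c
sum-const zero    c = refl
sum-const (suc n) c = cong (λ s → c + s) (sum-const n c)

prod-const : ∀ n c → prod {n} (λ _ → c) ≡ c ^ n
prod-const zero    c = refl
prod-const (suc n) c = cong (c *_) (prod-const n c)

sum-mono : ∀ {n} {f g : Fin n → ℕ} → (∀ i → f i ≤ g i) → sum f ≤ sum g
sum-mono {zero}  f≤g = z≤n
sum-mono {suc n} f≤g = +-mono-≤ (f≤g zero) (sum-mono (f≤g ∘ suc))

prod-mono : ∀ {n} {f g : Fin n → ℕ} → (∀ i → f i ≤ g i) → prod f ≤ prod g
prod-mono {zero}  f≤g = ≤-refl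
prod-mono {suc n} f≤g = *-mono-≤ (f≤g zero) (prod-mono (f≤g ∘ suc))

term≤sum : ∀ {n} (f : Fin n → ℕ) i → f i ≤ sum f
term≤sum f zero    = m≤m+n _ _
term≤sum f (suc i) = ≤-trans (term≤sum (f ∘ suc) i) (m≤n+m _ _)

average : ∀ {n} (f : Fin n → ℕ) K → sum f < n * K → ∃ λ i → f i < K
average {n} f K sf< with any? (λ i → f i <? K)
... | yes p = p
... | no ¬p = contradiction sf< (≤⇒≯ (≤-trans (≤-reflexive (sym (sum-const n K)))
                (sum-mono λ i → ≮⇒≥ λ fi<K → ¬p (i , fi<K))))

-- A partial colouring of `M` points; here `nothing` leaves a point unconstrained.
Pattern : ℕ → ℕ → Set
Pattern v M = Fin M → Maybe (Fin v)

size : ∀ {v M} → Pattern v M → ℕ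
size p = ∣ tabulate (is-just ∘ p) ∣

-- `nothing` is a pattern that the colours fixed so far already violate.
State : ℕ → ℕ → Set
State v M = Maybe (Pattern v M)

Touches : ∀ {v M} → State v M → Fin M → Set
Touches nothing  x = ⊥
Touches (just p) x = ∃ λ b → p x ≡ just b

SizeAtMost : ∀ {v M} → ℕ → State v M → Set
SizeAtMost N nothing  = Unit
SizeAtMost N (just p) = size p ≤ N

Matches : ∀ {v M} → (Fin M → Fin v) → State v M → Set
Matches c nothing  = ⊥
Matches c (just p) = ∀ x b → p x ≡ just b → c x ≡ b

Disjoint : ∀ {v M t} → (Fin t → State v M) → Set
Disjoint ss = ∀ i j x → Touches (ss i) x → Touches (ss j) x → i ≡ j

-- v ^ N times the probability that a uniform completion of the colouring violates the pattern.
weight : ∀ {v M} → ℕ → State v M → ℕ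
weight {v} N nothing  = v ^ N
weight {v} N (just p) = v ^ N ∸ v ^ (N ∸ size p)

stepHead : ∀ {v M} → Fin v → Maybe (Fin v) → Pattern v M → State v M
stepHead a nothing  p = just p
stepHead a (just b) p with a ≟ b
... | yes _ = just p
... | no  _ = nothing

step : ∀ {v M} → Fin v → State v (suc M) → State v M
step a nothing  = nothing
step a (just p) = stepHead a (p zero) (p ∘ suc)

stepHead-touches : ∀ {v M} (a : Fin v) h (p : Pattern v M) x →
  Touches (stepHead a h p) x → Touches (just p) x
stepHead-touches a nothing  p x t = t
stepHead-touches a (just b) p x t with a ≟ b
... | yes _ = t

step-touches : ∀ {v M} (a : Fin v) (s : State v (suc M)) x →
  Touches (step a s) x → Touches s (suc x)
step-touches a (just p) x t = stepHead-touches a (p zero) (p ∘ suc) x t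

size-tail : ∀ {v M} (p : Pattern v (suc M)) → size (p ∘ suc) ≤ size p
size-tail p with p zero
... | nothing = ≤-refl
... | just _  = n≤1+n _

stepHead-size : ∀ {v M N} (a : Fin v) h (p : Pattern v M) → size p ≤ N → SizeAtMost N (stepHead a h p)
stepHead-size a nothing  p le = le
stepHead-size a (just b) p le with a ≟ b
... | yes _ = le
... | no  _ = tt

step-size : ∀ {v M N} (a : Fin v) (s : State v (suc M)) → SizeAtMost N s → SizeAtMost N (step a s)
step-size a nothing  le = le
step-size a (just p) le = stepHead-size a (p zero) (p ∘ suc) (≤-trans (size-tail p) le)

_◂_ : ∀ {v M} → Fin v → (Fin M → Fin v) → Fin (suc M) → Fin v
(a ◂ c) zero    = a
(a ◂ c) (suc x) = c x

step-matches : ∀ {v M} (a : Fin v) (c : Fin M → Fin v) s → Matches c (step a s) → Matches (a ◂ c) s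
step-matches a c (just p) m x b eq with p zero in eq₀
step-matches a c (just p) m (suc x) b eq | nothing = m x b eq
step-matches a c (just p) m zero b eq | nothing with () ← trans (sym eq₀) eq
step-matches a c (just p) m x b eq | just b₀ with a ≟ b₀
step-matches a c (just p) m zero b eq | just b₀ | yes refl with refl ← trans (sym eq₀) eq = refl
step-matches a c (just p) m (suc x) b eq | just b₀ | yes a≡b = m x b eq

weight-untouched : ∀ {v M N} (s : State v (suc M)) → ¬ Touches s zero →
  ∀ a → weight N (step a s) ≡ weight N s
weight-untouched nothing  ¬t a = refl
weight-untouched (just p) ¬t a with p zero
... | nothing = refl
... | just b  = contradiction (b , refl) ¬t

sum-one-off : ∀ {n} (f : Fin (suc n) → ℕ) b α β → f b ≡ α → (∀ a → a ≢ b → f a ≡ β) → sum f ≡ α + n * β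
sum-one-off {n} f b α β fb f≠ = trans (sum-remove {i = b} f)
  (cong₂ _+_ fb (trans (sum-cong-≗ λ i → f≠ (punchIn b i) (punchInᵢ≢i b i)) (sum-const n β)))

stepHead-≡ : ∀ {v M} (b : Fin v) (p : Pattern v M) → stepHead b (just b) p ≡ just p
stepHead-≡ b p with b ≟ b
... | yes _ = refl
... | no b≢b = contradiction refl b≢b

stepHead-≢ : ∀ {v M} (a b : Fin v) (p : Pattern v M) → a ≢ b → stepHead a (just b) p ≡ nothing
stepHead-≢ a b p a≢b with a ≟ b
... | yes a≡b = contradiction a≡b a≢b
... | no _ = refl

-- The one right colour leaves a pattern with one constraint fewer, and each of the `v` wrong
-- colours contributes the full weight. The bound on `s` ensures that the truncated exponents really
-- differ by one.
weight-identity : ∀ v N s → suc s ≤ N →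
  (suc v ^ N ∸ suc v ^ (N ∸ s)) + v * suc v ^ N ≡ suc v * (suc v ^ N ∸ suc v ^ (N ∸ suc s))
weight-identity v N s s<N = begin
  (D ∸ suc v ^ (N ∸ s)) + v * D      ≡⟨ cong (λ z → (D ∸ z) + v * D) u-eq ⟩
  (D ∸ suc v * u) + v * D            ≡⟨ +-comm _ (v * D) ⟩
  v * D + (D ∸ suc v * u)            ≡⟨ +-∸-assoc (v * D) vu≤D ⟨
  (v * D + D) ∸ suc v * u            ≡⟨ cong (_∸ suc v * u) (+-comm (v * D) D) ⟩
  suc v * D ∸ suc v * u              ≡⟨ *-distribˡ-∸ (suc v) D u ⟨
  suc v * (D ∸ u)                    ∎
  where
  open ≡-Reasoning
  D = suc v ^ N
  u = suc v ^ (N ∸ suc s)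
  u-eq : suc v ^ (N ∸ s) ≡ suc v * u
  u-eq = cong (suc v ^_) (+-∸-assoc 1 s<N)
  vu≤D : suc v * u ≤ D
  vu≤D = subst (_≤ D) u-eq (^-monoʳ-≤ (suc v) (m∸n≤m N s))

-- Only the prescribed colour `b` keeps the pattern alive; the sum expresses a probability as the
-- average of its conditional values.
weight-touched : ∀ {v M N} (s : State (suc v) (suc M)) → SizeAtMost N s → Touches s zero →
  sum (λ a → weight N (step a s)) ≡ suc v * weight N s
weight-touched {v} {M} {N} (just p) le (b , eq) with p zero
weight-touched {v} {M} {N} (just p) le (b , refl) | just .b = trans
  (sum-one-off _ b _ (suc v ^ N)
    (cong (weight N) (stepHead-≡ b (p ∘ suc)))
    (λ a a≢b → cong (weight N) (stepHead-≢ a b (p ∘ suc) a≢b)))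
  (weight-identity v N (size (p ∘ suc)) le)

touches? : ∀ {v M} (s : State v M) x → Dec (Touches s x)
touches? nothing  x = no λ ()
touches? (just p) x with p x
... | nothing = no λ ()
... | just b  = yes (b , refl)

-- For disjoint patterns of size at most `N` the violations are independent, so this is
-- `(v ^ N) ^ t` times the probability that all `t` patterns are violated.
potential : ∀ {v M t} → ℕ → (Fin t → State v M) → ℕ
potential N ss = prod (λ j → weight N (ss j))

-- By disjointness at most one factor depends on the colour of the first point.
potential-step : ∀ {v M t N} (ss : Fin t → State (suc v) (suc M)) → (∀ j → SizeAtMost N (ss j)) → Disjoint ss →
  sum (λ a → potential N (step a ∘ ss)) ≡ suc v * potential N ss
potential-step {v} {t = zero}  ss le dj = sum-const (suc v) 1
potential-step {v} {t = suc t} {N} ss le dj with touches? (ss zero) zero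
... | no ¬t = begin
  sum (λ a → weight N (step a (ss zero)) * potential N (step a ∘ ss ∘ suc))
    ≡⟨ sum-cong-≗ (λ a → cong (_* potential N (step a ∘ ss ∘ suc)) (weight-untouched {N = N} (ss zero) ¬t a)) ⟩
  sum (λ a → w * potential N (step a ∘ ss ∘ suc))
    ≡⟨ *-distribˡ-sum w (λ a → potential N (step a ∘ ss ∘ suc)) ⟨
  w * sum (λ a → potential N (step a ∘ ss ∘ suc))
    ≡⟨ cong (w *_) (potential-step (ss ∘ suc) (le ∘ suc) (λ i j x p q → suc-injective (dj (suc i) (suc j) x p q))) ⟩
  w * (suc v * rest)
    ≡⟨ *-assoc w (suc v) rest ⟨
  w * suc v * rest
    ≡⟨ cong (_* rest) (*-comm w (suc v)) ⟩
  suc v * w * rest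
    ≡⟨ *-assoc (suc v) w rest ⟩
  suc v * (w * rest) ∎
  where
  open ≡-Reasoning
  w = weight N (ss zero)
  rest = potential N (ss ∘ suc)
... | yes t₀ = begin
  sum (λ a → weight N (step a (ss zero)) * potential N (step a ∘ ss ∘ suc))
    ≡⟨ sum-cong-≗ (λ a → cong (weight N (step a (ss zero)) *_)
         (prod-cong (λ j → weight-untouched {N = N} (ss (suc j)) (untouched j) a))) ⟩
  sum (λ a → weight N (step a (ss zero)) * rest)
    ≡⟨ *-distribʳ-sum rest (λ a → weight N (step a (ss zero))) ⟨
  sum (λ a → weight N (step a (ss zero))) * rest
    ≡⟨ cong (_* rest) (weight-touched (ss zero) (le zero) t₀) ⟩
  suc v * weight N (ss zero) * rest
    ≡⟨ *-assoc (suc v) (weight N (ss zero)) rest ⟩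
  suc v * (weight N (ss zero) * rest) ∎
  where
  open ≡-Reasoning
  rest = potential N (ss ∘ suc)
  untouched : ∀ j → ¬ Touches (ss (suc j)) zero
  untouched j t with () ← dj zero (suc j) zero t₀ t

-- With no points left, a violated pattern has weight `v ^ N`; if all were violated, the product
-- would reach the bound. A surviving pattern is matched vacuously.
some-alive : ∀ {v t N} (ss : Fin t → State v 0) → potential N ss < (v ^ N) ^ t →
  ∀ (c : Fin 0 → Fin v) → ∃ λ j → Matches c (ss j)
some-alive {t = zero} ss (s≤s ()) c
some-alive {v} {suc t} {N} ss pot< c with ss zero in eq
... | just p = zero , subst (Matches c) (sym eq) (λ ())
... | nothing with j , m ← some-alive {N = N} (ss ∘ suc) (*-cancelˡ-< (v ^ N) _ _ pot<) c = suc j , m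

total-step : ∀ {v K t M N} (ss : Fin K → Fin t → State (suc v) (suc M)) →
  (∀ κ j → SizeAtMost N (ss κ j)) → (∀ κ → Disjoint (ss κ)) →
  sum (λ a → sum (λ κ → potential N (step a ∘ ss κ))) ≡ suc v * sum (λ κ → potential N (ss κ))
total-step {v} {N = N} ss le dj = begin
  sum (λ a → sum (λ κ → potential N (step a ∘ ss κ)))
    ≡⟨ ∑-comm (λ a κ → potential N (step a ∘ ss κ)) ⟩
  sum (λ κ → sum (λ a → potential N (step a ∘ ss κ)))
    ≡⟨ sum-cong-≗ (λ κ → potential-step (ss κ) (le κ) (dj κ)) ⟩
  sum (λ κ → suc v * potential N (ss κ))
    ≡⟨ *-distribˡ-sum (suc v) (λ κ → potential N (ss κ)) ⟨
  suc v * sum (λ κ → potential N (ss κ)) ∎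
  where open ≡-Reasoning

-- Method of conditional expectations: colour the points one at a time, never letting
-- the total potential increase.
colouring-exists : ∀ {v K t N} M (ss : Fin K → Fin t → State (suc v) M) →
  (∀ κ j → SizeAtMost N (ss κ j)) → (∀ κ → Disjoint (ss κ)) →
  sum (λ κ → potential N (ss κ)) < (suc v ^ N) ^ t →
  ∃ λ (c : Fin M → Fin (suc v)) → ∀ κ → ∃ λ j → Matches c (ss κ j)
colouring-exists {N = N} zero ss le dj pot< = (λ ()) , λ κ →
  some-alive {N = N} (ss κ) (≤-<-trans (term≤sum (λ κ → potential N (ss κ)) κ) pot<) (λ ())
colouring-exists {v} {K} {t} {N} (suc M) ss le dj pot<
  with a , a< ← average (λ a → sum (λ κ → potential N (step a ∘ ss κ))) ((suc v ^ N) ^ t)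
                (≤-<-trans (≤-reflexive (total-step ss le dj)) (*-monoʳ-< (suc v) pot<))
  with c , m ← colouring-exists {N = N} M (λ κ j → step a (ss κ j)) (λ κ j → step-size a (ss κ j) (le κ j))
                (λ κ i j x p q → dj κ i j (suc x) (step-touches a (ss κ i) x p) (step-touches a (ss κ j) x q)) a<
  = a ◂ c , λ κ → proj₁ (m κ) , step-matches a c (ss κ (proj₁ (m κ))) (proj₂ (m κ))

-- Subsets and their images

-- Each element of `T` uses up a source in `S`, which functionality bars from serving any other, so
-- it can be deleted. A relation rather than a function allows use on inverses of injections.
card≤ : ∀ {a b} {R : Fin a → Fin b → Set} → (∀ {i t t'} → R i t → R i t' → t ≡ t') →
  (S : Subset a) (T : Subset b) → (∀ t → t ∈ T → ∃ λ i → i ∈ S × R i t) → ∣ T ∣ ≤ ∣ S ∣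
card≤ fn S [] cover = z≤n
card≤ {R = R} fn S (outside ∷ T) cover =
  card≤ {R = λ i t → R i (suc t)} (λ p q → suc-injective (fn p q)) S T (λ t t∈T → cover (suc t) (there t∈T))
card≤ {R = R} fn S (inside ∷ T) cover with i₀ , i₀∈S , r₀ ← cover zero here =
  ≤-<-trans
    (card≤ {R = λ i t → R i (suc t)} (λ p q → suc-injective (fn p q)) (S - i₀) T λ t t∈T →
      let i , i∈S , r = cover (suc t) (there t∈T) in
      i , x∈p∧x≢y⇒x∈p-y i∈S (λ i≡i₀ → contradiction (fn r₀ (subst (λ i → R i (suc t)) i≡i₀ r)) λ ()) , r)
    (x∈p⇒∣p-x∣<∣p∣ i₀∈S)

BijOn⇒card≡ : ∀ {a b} {h : Fin a → Fin b} {S T} → BijOn h S T → ∣ S ∣ ≡ ∣ T ∣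
BijOn⇒card≡ {h = h} {S} {T} (to , inj , surj) = ≤-antisym
  (card≤ {R = λ t i → i ∈ S × h i ≡ t} (λ { (p , e) (q , e') → inj _ _ p q (trans e (sym e')) }) T S
    (λ i i∈S → h i , to i i∈S , i∈S , refl))
  (card≤ {R = λ i t → h i ≡ t} (λ e e' → trans (sym e) e') S T surj)

image : ∀ {a b} → (Fin a → Fin b) → Subset a → Subset b
image φ S = tabulate λ y → does (any? λ i → (i ∈? S) ×-dec (φ i ≟ y))

∈-image⁻ : ∀ {a b} (φ : Fin a → Fin b) S {y} → y ∈ image φ S → ∃ λ i → i ∈ S × φ i ≡ y
∈-image⁻ φ S {y} y∈ with any? (λ i → (i ∈? S) ×-dec (φ i ≟ y)) | trans (sym (lookup∘tabulate _ y)) ([]=⇒lookup y∈)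
... | yes p | _ = p

∈-image⁺ : ∀ {a b} (φ : Fin a → Fin b) S i → i ∈ S → φ i ∈ image φ S
∈-image⁺ φ S i i∈S = lookup⇒[]= (φ i) _ (trans (lookup∘tabulate _ (φ i)) (dec-true (any? _) (i , i∈S , refl)))

image-IsImage : ∀ {a b} (φ : Fin a → Fin b) S → IsImage φ S (image φ S)
image-IsImage φ S = ∈-image⁺ φ S , λ j → ∈-image⁻ φ S

image-BijOn : ∀ {a b} (φ : Fin a → Fin b) S → (∀ i j → i ∈ S → j ∈ S → φ i ≡ φ j → i ≡ j) → BijOn φ S (image φ S)
image-BijOn φ S inj = ∈-image⁺ φ S , inj , λ j → ∈-image⁻ φ S

encodeBit : Bool → Fin 2
encodeBit true  = zero
encodeBit false = suc zero

encodeBit-injective : ∀ b b' → encodeBit b ≡ encodeBit b' → b ≡ b'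
encodeBit-injective true  true  _ = refl
encodeBit-injective false false _ = refl

encodeSubset : ∀ {n} → Subset n → Fin (2 ^ n)
encodeSubset []      = zero
encodeSubset (b ∷ S) = combine (encodeBit b) (encodeSubset S)

encodeSubset-injective : ∀ {n} (S T : Subset n) → encodeSubset S ≡ encodeSubset T → S ≡ T
encodeSubset-injective [] [] _ = refl
encodeSubset-injective (b ∷ S) (b' ∷ T) eq
  with eqb , eqS ← combine-injective (encodeBit b) (encodeSubset S) (encodeBit b') (encodeSubset T) eq
  = cong₂ _∷_ (encodeBit-injective b b' eqb) (encodeSubset-injective S T eqS)

-- Numbers the points to be coloured. All pairs are numbered, also those with `i` outside `S` or `S`
-- of the wrong size.
encode : ∀ {n} → Subset n → Fin n → Fin (2 ^ n * n)
encode S i = combine (encodeSubset S) i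

encode-injective : ∀ {n} (S T : Subset n) i j → encode S i ≡ encode T j → S ≡ T × i ≡ j
encode-injective S T i j eq with eqS , eqi ← combine-injective (encodeSubset S) i (encodeSubset T) j eq =
  encodeSubset-injective S T eqS , eqi

-- Polynomial codes

evalℤ : ∀ {k} → Vec ℤ k → ℤ → ℤ
evalℤ []      x = 0ℤ
evalℤ (c ∷ p) x = c ℤ.+ x ℤ.* evalℤ p x

-- Synthetic division by `x - a`, constant coefficient first: the quotient consists of the Horner
-- values of the successive tails at `a`.
divide : ∀ {k} → Vec ℤ (suc k) → ℤ → Vec ℤ k
divide (c ∷ [])        a = []
divide (c ∷ p@(_ ∷ _)) a = evalℤ p a ∷ divide p a

remainder-identity : ∀ c x a q r →
  c ℤ.+ x ℤ.* (q ℤ.+ (x ℤ.- a) ℤ.* r) ≡ (c ℤ.+ a ℤ.* q) ℤ.+ (x ℤ.- a) ℤ.* (q ℤ.+ x ℤ.* r)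
remainder-identity = solveℤ-∀

constant-identity : ∀ c x a → c ℤ.+ x ℤ.* 0ℤ ≡ (c ℤ.+ a ℤ.* 0ℤ) ℤ.+ (x ℤ.- a) ℤ.* 0ℤ
constant-identity = solveℤ-∀

divide-correct : ∀ {k} (p : Vec ℤ (suc k)) a x → evalℤ p x ≡ evalℤ p a ℤ.+ (x ℤ.- a) ℤ.* evalℤ (divide p a) x
divide-correct (c ∷ [])        a x = constant-identity c x a
divide-correct (c ∷ p@(_ ∷ _)) a x = trans (cong (λ z → c ℤ.+ x ℤ.* z) (divide-correct p a x))
  (remainder-identity c x a (evalℤ p a) (evalℤ (divide p a) x))

Zero : ∀ {k} → Vec ℤ k → Set
Zero = All (_≡ 0ℤ)

constant-zero : ∀ c a z → z ≡ 0ℤ → c ℤ.+ a ℤ.* z ≡ 0ℤ → c ≡ 0ℤ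
constant-zero c a .0ℤ refl eq = trans (sym (trans (cong (λ z → c ℤ.+ z) (ℤₚ.*-zeroʳ a)) (ℤₚ.+-identityʳ c))) eq

divide-zero : ∀ {k} (p : Vec ℤ (suc k)) a → evalℤ p a ≡ 0ℤ → Zero (divide p a) → Zero p
divide-zero (c ∷ [])        a eq _         = constant-zero c a 0ℤ refl eq ∷ []
divide-zero (c ∷ p@(_ ∷ _)) a eq (eq' ∷ z) = constant-zero c a (evalℤ p a) eq' eq ∷ divide-zero p a eq' z

-- Each member of `S` allows a linear factor to be divided out, and the other roots pass to the
-- quotient because ℤ has no zero divisors. Working over ℤ puts no primality condition on `q`.
roots⇒zero : ∀ {v k} (x : Fin v → ℤ) → (∀ i j → x i ≡ x j → i ≡ j) → (S : Subset v) → k ≤ ∣ S ∣ →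
  (p : Vec ℤ k) → (∀ i → i ∈ S → evalℤ p (x i) ≡ 0ℤ) → Zero p
roots⇒zero x inj S k≤ [] root = []
roots⇒zero x inj (outside ∷ S) k≤ p@(_ ∷ _) root =
  roots⇒zero (x ∘ suc) (λ i j e → suc-injective (inj (suc i) (suc j) e)) S k≤ p (λ i i∈S → root (suc i) (there i∈S))
roots⇒zero x inj (inside ∷ S) (s≤s k≤) p@(_ ∷ _) root = divide-zero p (x zero) (root zero here)
  (roots⇒zero (x ∘ suc) (λ i j e → suc-injective (inj (suc i) (suc j) e)) S k≤ (divide p (x zero)) root')
  where
  root' : ∀ i → i ∈ S → evalℤ (divide p (x zero)) (x (suc i)) ≡ 0ℤ
  root' i i∈S with ℤₚ.i*j≡0⇒i≡0∨j≡0 (x (suc i) ℤ.- x zero) product≡0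
    where
    product≡0 : (x (suc i) ℤ.- x zero) ℤ.* evalℤ (divide p (x zero)) (x (suc i)) ≡ 0ℤ
    product≡0 = begin
      d                        ≡⟨ ℤₚ.+-identityˡ d ⟨
      0ℤ ℤ.+ d                 ≡⟨ cong (ℤ._+ d) (root zero here) ⟨
      evalℤ p (x zero) ℤ.+ d   ≡⟨ divide-correct p (x zero) (x (suc i)) ⟨
      evalℤ p (x (suc i))      ≡⟨ root (suc i) (there i∈S) ⟩
      0ℤ                       ∎
      where
      open ≡-Reasoning
      d = (x (suc i) ℤ.- x zero) ℤ.* evalℤ (divide p (x zero)) (x (suc i))
  ... | inj₁ e = contradiction (inj (suc i) zero (ℤₚ.i-j≡0⇒i≡j _ _ e)) λ ()
  ... | inj₂ e = e

eval : ∀ {k} → (Fin k → ℕ) → ℕ → ℕ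
eval {zero}  c x = 0
eval {suc k} c x = c zero + x * eval (c ∘ suc) x

-- The sum `1 + v + ... + v ^ (k - 1)`.
geometric : ℕ → ℕ → ℕ
geometric v zero    = 0
geometric v (suc k) = suc (v * geometric v k)

-- Strictness comes from the constant coefficient; the tail, possibly empty, only gets the weak
-- bound `eval-≤`.
eval-< : ∀ {k v q} (c : Fin (suc k) → Fin q) {x} → x ≤ v → eval (toℕ ∘ c) x < geometric v (suc k) * q

eval-≤ : ∀ {k v q} (c : Fin k → Fin q) {x} → x ≤ v → eval (toℕ ∘ c) x ≤ geometric v k * q
eval-≤ {zero}  c x≤v = z≤n
eval-≤ {suc k} c x≤v = <⇒≤ (eval-< c x≤v)

eval-< {k} {v} {q} c x≤v = +-mono-<-≤ (toℕ<n (c zero))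
  (≤-trans (*-mono-≤ x≤v (eval-≤ (c ∘ suc) x≤v)) (≤-reflexive (sym (*-assoc v (geometric v k) q))))

difference : ∀ {k} → (Fin k → ℕ) → (Fin k → ℕ) → Vec ℤ k
difference c c' = tabulate (λ i → + c i ℤ.- + c' i)

sub-identity : ∀ a x b c d → (a ℤ.- c) ℤ.+ x ℤ.* (b ℤ.- d) ≡ (a ℤ.+ x ℤ.* b) ℤ.- (c ℤ.+ x ℤ.* d)
sub-identity = solveℤ-∀

cast-horner : ∀ c x e → + (c + x * e) ≡ + c ℤ.+ + x ℤ.* + e
cast-horner c x e = trans (ℤₚ.pos-+ c (x * e)) (cong (λ z → + c ℤ.+ z) (ℤₚ.pos-* x e))

evalℤ-difference : ∀ {k} (c c' : Fin k → ℕ) x → evalℤ (difference c c') (+ x) ≡ + eval c x ℤ.- + eval c' x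
evalℤ-difference {zero}  c c' x = refl
evalℤ-difference {suc k} c c' x = begin
  (+ c zero ℤ.- + c' zero) ℤ.+ + x ℤ.* evalℤ (difference (c ∘ suc) (c' ∘ suc)) (+ x)
    ≡⟨ cong (λ z → (+ c zero ℤ.- + c' zero) ℤ.+ + x ℤ.* z) (evalℤ-difference (c ∘ suc) (c' ∘ suc) x) ⟩
  (+ c zero ℤ.- + c' zero) ℤ.+ + x ℤ.* (+ eval (c ∘ suc) x ℤ.- + eval (c' ∘ suc) x)
    ≡⟨ sub-identity (+ c zero) (+ x) (+ eval (c ∘ suc) x) (+ c' zero) (+ eval (c' ∘ suc) x) ⟩
  (+ c zero ℤ.+ + x ℤ.* + eval (c ∘ suc) x) ℤ.- (+ c' zero ℤ.+ + x ℤ.* + eval (c' ∘ suc) x)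
    ≡⟨ cong₂ ℤ._-_ (cast-horner (c zero) x (eval (c ∘ suc) x)) (cast-horner (c' zero) x (eval (c' ∘ suc) x)) ⟨
  + eval c x ℤ.- + eval c' x ∎
  where open ≡-Reasoning

difference-zero : ∀ {k} (c c' : Fin k → ℕ) → Zero (difference c c') → ∀ i → c i ≡ c' i
difference-zero c c' (e ∷ z) zero    = ℤₚ.+-injective (ℤₚ.i-j≡0⇒i≡j _ _ e)
difference-zero c c' (e ∷ z) (suc i) = difference-zero (c ∘ suc) (c' ∘ suc) z i

eval-agree : ∀ {v k} (c c' : Fin k → ℕ) (S : Subset v) → k ≤ ∣ S ∣ →
  (∀ a → a ∈ S → eval c (toℕ a) ≡ eval c' (toℕ a)) → ∀ i → c i ≡ c' i
eval-agree c c' S k≤ agree = difference-zero c c'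
  (roots⇒zero (λ a → + toℕ a) (λ i j e → toℕ-injective (ℤₚ.+-injective e)) S k≤ (difference c c')
    λ a a∈S → trans (evalℤ-difference c c' (toℕ a)) (ℤₚ.i≡j⇒i-j≡0 (cong +_ (agree a a∈S))))

-- An integer analogue of a Reed-Solomon code: the base-`q` digits of `j` are the coefficients,
-- evaluated at `0, ..., v - 1`. Here `k` is one less than the shadow size.
codeword : ∀ k q v → Fin (q ^ suc k) → Fin v → Fin (geometric v (suc k) * q)
codeword k q v j a = fromℕ< (eval-< (finToFun {q} {suc k} j) (<⇒≤ (toℕ<n a)))

funToFin-cong : ∀ {m n} {f g : Fin m → Fin n} → (∀ i → f i ≡ g i) → funToFin f ≡ funToFin g
funToFin-cong {zero}  eq = refl
funToFin-cong {suc m} eq = cong₂ combine (eq zero) (funToFin-cong (eq ∘ suc))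

codeword-agree : ∀ k q {v} (j j' : Fin (q ^ suc k)) (S : Subset v) → ∣ S ∣ ≡ suc k →
  (∀ a → a ∈ S → codeword k q v j a ≡ codeword k q v j' a) → j ≡ j'
codeword-agree k q {v} j j' S card agree = begin
  j                                    ≡⟨ funToFin-finToFin {suc k} {q} j ⟨
  funToFin (finToFun {q} {suc k} j)    ≡⟨ funToFin-cong (λ i → toℕ-injective (coefficients i)) ⟩
  funToFin (finToFun {q} {suc k} j')   ≡⟨ funToFin-finToFin {suc k} {q} j' ⟩
  j'                                   ∎
  where
  open ≡-Reasoning
  coefficients : ∀ i → toℕ (finToFun {q} {suc k} j i) ≡ toℕ (finToFun {q} {suc k} j' i)
  coefficients = eval-agree (toℕ ∘ finToFun {q} {suc k} j) (toℕ ∘ finToFun {q} {suc k} j') S (≤-reflexive (sym card))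
    λ a a∈S → fromℕ<-injective _ _ (eval-< (finToFun {q} {suc k} j) (<⇒≤ (toℕ<n a))) (eval-< (finToFun {q} {suc k} j') (<⇒≤ (toℕ<n a))) (agree a a∈S)

-- The graph of a colouring

Colouring : ℕ → ℕ → Set
Colouring n v = Subset n → Fin n → Fin v

ShadowGraph : ∀ {n v} → ℕ → Hypergraph v → Colouring n v → Hypergraph n
ShadowGraph {n} {v} k F g e = Σ (Subset v) λ e' → F e' × Σ (Fin n → Fin v) λ h →
  BijOn h e e' × (∀ T → ∣ T ∣ ≡ k → T ⊆ e → ∀ x → x ∈ T → h x ≡ g T x)

shadowGraph-uniform : ∀ {n v r k} {F : Hypergraph v} {g : Colouring n v} →
  IsRGraph r F → IsRGraph r (ShadowGraph k F g)
shadowGraph-uniform unif e (e' , Fe' , h , bij , _) = trans (BijOn⇒card≡ bij) (unif e' Fe')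

injective-card : ∀ {a b} {φ : Fin a → Fin b} → Injective _≡_ _≡_ φ → ∀ S → ∣ image φ S ∣ ≡ ∣ S ∣
injective-card {φ = φ} inj S = sym (BijOn⇒card≡ (image-BijOn φ S λ i j _ _ → inj))

-- Pulling the colouring back along `φ` gives maps that depend on `S` alone, not on an edge
-- containing it, as a shadow homomorphism requires. On each edge they agree with the bijection that
-- made its image an edge.
shadowGraph-free : ∀ {n v w k} {F : Hypergraph v} {G : Hypergraph w} {g : Colouring n v} →
  ¬ ShadowHom k G F → Free G (ShadowGraph k F g)
shadowGraph-free {n} {v} {w} {k} {F} {G} {g} ¬hom (φ , inj , emb) =
  ¬hom ((λ S _ → image (gS S) S) , (λ S _ → gS S) , shadow , edge)
  where
  gS : Subset w → Fin w → Fin v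
  gS S i = g (image φ S) (φ i)

  image-⊆ : ∀ {S e e₁} → IsImage φ e e₁ → S ⊆ e → image φ S ⊆ e₁
  image-⊆ {S} (to , _) S⊆e x∈ with i , i∈S , refl ← ∈-image⁻ φ S x∈ = to i (S⊆e i∈S)

  shadow : ∀ S (p : InShadow k G S) → InShadow k F (image (gS S) S) × BijOn (gS S) S (image (gS S) S)
  shadow S (card , e , Ge , S⊆e)
    with e₁ , im , e₂ , Fe₂ , h , (h-to , h-inj , _) , agree ← emb e Ge =
    (trans (sym (BijOn⇒card≡ bij)) card , e₂ , Fe₂ , sub) , bij
    where
    h≡ : ∀ i → i ∈ S → h (φ i) ≡ gS S i
    h≡ i i∈S = agree (image φ S) (trans (injective-card inj S) card) (image-⊆ im S⊆e) (φ i) (∈-image⁺ φ S i i∈S)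
    bij : BijOn (gS S) S (image (gS S) S)
    bij = image-BijOn (gS S) S λ i j i∈S j∈S eq →
      inj (h-inj _ _ (proj₁ im i (S⊆e i∈S)) (proj₁ im j (S⊆e j∈S)) (trans (h≡ i i∈S) (trans eq (sym (h≡ j j∈S)))))
    sub : image (gS S) S ⊆ e₂
    sub y∈ with i , i∈S , refl ← ∈-image⁻ (gS S) S y∈ = subst (_∈ e₂) (h≡ i i∈S) (h-to (φ i) (proj₁ im i (S⊆e i∈S)))

  edge : ∀ e → G e → Σ (Subset v) λ e' → F e' × Σ (Fin w → Fin v) λ h →
    BijOn h e e' × (∀ S (p : InShadow k G S) → S ⊆ e → ∀ i → i ∈ S → h i ≡ gS S i)
  edge e Ge with e₁ , im , e₂ , Fe₂ , h , (h-to , h-inj , h-surj) , agree ← emb e Ge =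
    e₂ , Fe₂ , h ∘ φ ,
    ((λ i i∈e → h-to (φ i) (proj₁ im i i∈e)) ,
     (λ i j i∈e j∈e eq → inj (h-inj _ _ (proj₁ im i i∈e) (proj₁ im j j∈e) eq)) ,
     surj) ,
    (λ S p S⊆e i i∈S → agree (image φ S) (trans (injective-card inj S) (proj₁ p)) (image-⊆ im S⊆e) (φ i) (∈-image⁺ φ S i i∈S))
    where
    surj : ∀ t → t ∈ e₂ → Σ (Fin w) λ i → i ∈ e × h (φ i) ≡ t
    surj t t∈ with y , y∈ , refl ← h-surj t t∈ with i , i∈e , refl ← proj₂ im y y∈ = i , i∈e , refl

Inverts : ∀ {n v} → ℕ → Colouring n v → (Fin v → Fin n) → Set
Inverts k g θ = ∀ S → ∣ S ∣ ≡ k → ∀ i → g (image θ S) (θ i) ≡ i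

-- Off the image of `θ` the value is the default `zero`, which needs a vertex; an `F` without
-- vertices is treated separately.
inverse : ∀ {n v} → (Fin (suc v) → Fin n) → Fin n → Fin (suc v)
inverse θ y with any? (λ i → θ i ≟ y)
... | yes (i , _) = i
... | no  _       = zero

inverse-left : ∀ {n v} {θ : Fin (suc v) → Fin n} → Injective _≡_ _≡_ θ → ∀ i → inverse θ (θ i) ≡ i
inverse-left {θ = θ} inj i with any? (λ j → θ j ≟ θ i)
... | yes (_ , eq) = inj eq
... | no  ¬p       = contradiction (i , refl) ¬p

-- The bijection back to `e` is `inverse θ`. Every `k`-subset of `image θ e` is `image θ S` for a
-- `k`-subset `S`, where `Inverts` says that the colouring agrees with it.
shadowGraph-edge : ∀ {n v k} {F : Hypergraph (suc v)} {g : Colouring n (suc v)} {θ : Fin (suc v) → Fin n} →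
  Injective _≡_ _≡_ θ → Inverts k g θ → ∀ e → F e → ShadowGraph k F g (image θ e)
shadowGraph-edge {n} {v} {k} {F} {g} {θ} inj inv e Fe = e , Fe , inverse θ , (to , injOn , surj) , agree
  where
  to : ∀ y → y ∈ image θ e → inverse θ y ∈ e
  to y y∈ with i , i∈e , refl ← ∈-image⁻ θ e y∈ = subst (_∈ e) (sym (inverse-left inj i)) i∈e
  injOn : ∀ y z → y ∈ image θ e → z ∈ image θ e → inverse θ y ≡ inverse θ z → y ≡ z
  injOn y z y∈ z∈ eq with i , _ , refl ← ∈-image⁻ θ e y∈ | j , _ , refl ← ∈-image⁻ θ e z∈ =
    cong θ (trans (sym (inverse-left inj i)) (trans eq (inverse-left inj j)))
  surj : ∀ i → i ∈ e → Σ (Fin n) λ y → y ∈ image θ e × inverse θ y ≡ i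
  surj i i∈e = θ i , ∈-image⁺ θ e i i∈e , inverse-left inj i
  agree : ∀ T → ∣ T ∣ ≡ k → T ⊆ image θ e → ∀ y → y ∈ T → inverse θ y ≡ g T y
  agree T card T⊆ y y∈T with i , _ , refl ← ∈-image⁻ θ e (T⊆ y∈T) =
    trans (inverse-left inj i) (sym (trans (cong (λ T → g T (θ i)) T≡) (inv S (trans cardS card) i)))
    where
    S = image (inverse θ) T
    T≡ : T ≡ image θ S
    T≡ = ⊆-antisym
      (λ z∈ → let j , _ , eq = ∈-image⁻ θ e (T⊆ z∈) in
        subst (_∈ image θ S) (trans (cong (θ ∘ inverse θ) (sym eq)) (trans (cong θ (inverse-left inj j)) eq))
          (∈-image⁺ θ S _ (∈-image⁺ (inverse θ) T _ z∈)))
      λ z∈ → let j , j∈ , eq = ∈-image⁻ θ S z∈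
                 w , w∈ , eq' = ∈-image⁻ (inverse θ) T j∈
                 l , _ , eq'' = ∈-image⁻ θ e (T⊆ w∈)
             in subst (_∈ T) (trans (sym eq'') (trans (cong θ (sym (inverse-left inj l))) (trans (cong (θ ∘ inverse θ) eq'') (trans (cong θ eq') eq)))) w∈
    cardS : ∣ S ∣ ≡ ∣ T ∣
    cardS = trans (sym (injective-card inj S)) (cong ∣_∣ (sym T≡))

-- The equation for `θ` is pointwise because `θ` will be built from `ψ` decoded from its number,
-- which agrees with `ψ` only pointwise.
shadowGraph-contains : ∀ {n v m k} {F : Hypergraph (suc v)} {g : Colouring n (suc v)}
  {ψ : Fin m → Fin n} {χ : Fin (suc v) → Fin m} {θ : Fin (suc v) → Fin n} →
  Injective _≡_ _≡_ ψ → Injective _≡_ _≡_ χ → (∀ a → θ a ≡ ψ (χ a)) → Inverts k g θ →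
  Contains (Induced (ShadowGraph k F g) ψ) F
shadowGraph-contains {ψ = ψ} {χ} {θ} ψ-inj χ-inj θ≡ inv = χ , χ-inj , λ e Fe →
  image χ e , image-IsImage χ e , image θ e ,
  ((λ y y∈ → let i , i∈ , eq = ∈-image⁻ χ e y∈ in
      subst (_∈ image θ e) (trans (θ≡ i) (cong ψ eq)) (∈-image⁺ θ e i i∈)) ,
   (λ z z∈ → let i , i∈ , eq = ∈-image⁻ θ e z∈ in χ i , ∈-image⁺ χ e i i∈ , trans (sym (θ≡ i)) eq)) ,
  shadowGraph-edge (λ {i} {j} eq → χ-inj (ψ-inj (trans (sym (θ≡ i)) (trans eq (θ≡ j))))) inv e Fe

-- Inverted embeddings as patterns

Constrains : ∀ {n v} → ℕ → (Fin v → Fin n) → Fin (2 ^ n * n) → Subset v → Fin v → Set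
Constrains k θ y S i = ∣ S ∣ ≡ k × encode (image θ S) (θ i) ≡ y

-- If the guard A fails, the pattern is empty; A will be injectivity of the map of the m-set.
constraint? : ∀ {n v} {A : Set} k (A? : Dec A) (θ : Fin v → Fin n) y → Dec (A × ∃ λ S → ∃ λ i → Constrains k θ y S i)
constraint? k A? θ y = A? ×-dec anySubset? λ S → any? λ i → (∣ S ∣ ℕₚ.≟ k) ×-dec (encode (image θ S) (θ i) ≟ y)

-- The partial colouring demanded by `Inverts`. For injective `θ` the colour does not depend on the
-- witness found.
invertsPattern : ∀ {n v} {A : Set} → ℕ → Dec A → (Fin v → Fin n) → Pattern v (2 ^ n * n)
invertsPattern k A? θ y with constraint? k A? θ y
... | yes (_ , S , i , _) = just i
... | no  _               = nothing

invertsPattern-sound : ∀ {n v} {A : Set} k (A? : Dec A) (θ : Fin v → Fin n) y → Touches (just (invertsPattern k A? θ)) y →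
  A × ∃ λ S → ∃ λ i → Constrains k θ y S i
invertsPattern-sound k A? θ y (b , eq) with constraint? k A? θ y
... | yes p = p

invertsPattern-complete : ∀ {n v} {A : Set} k (A? : Dec A) (θ : Fin v → Fin n) → A → Injective _≡_ _≡_ θ →
  ∀ S → ∣ S ∣ ≡ k → ∀ i → invertsPattern k A? θ (encode (image θ S) (θ i)) ≡ just i
invertsPattern-complete k A? θ a inj S card i with constraint? k A? θ (encode (image θ S) (θ i))
... | yes (_ , S' , i' , _ , eq) = cong just (inj (proj₂ (encode-injective (image θ S') (image θ S) (θ i') (θ i) eq)))
... | no ¬p = contradiction (a , S , i , card , refl) ¬p

-- Every constrained point comes from a pair `(S , i)` on the side of `Fin v`, so the bound, and
-- with it `D`, is independent of `n`.
invertsPattern-size : ∀ {n v} {A : Set} k (A? : Dec A) (θ : Fin v → Fin n) → size (invertsPattern k A? θ) ≤ 2 ^ v * v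
invertsPattern-size {n} {v} k A? θ = subst (size p ≤_) (∣⊤∣≡n (2 ^ v * v)) (card≤ functional ⊤ (tabulate (is-just ∘ p)) cover)
  where
  p = invertsPattern k A? θ
  R : Fin (2 ^ v * v) → Fin (2 ^ n * n) → Set
  R z y = ∃ λ S → ∃ λ i → z ≡ encode S i × encode (image θ S) (θ i) ≡ y
  functional : ∀ {z y y'} → R z y → R z y' → y ≡ y'
  functional (S , i , eq , refl) (S' , i' , eq' , refl)
    with refl , refl ← encode-injective S S' i i' (trans (sym eq) eq') = refl
  touched : ∀ y → is-just (p y) ≡ true → Touches (just p) y
  touched y eq with p y
  ... | just b = b , refl
  cover : ∀ y → y ∈ tabulate (is-just ∘ p) → ∃ λ z → z ∈ ⊤ × R z y
  cover y y∈ with _ , S , i , _ , eq ← invertsPattern-sound k A? θ y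
                     (touched y (trans (sym (lookup∘tabulate (is-just ∘ p) y)) ([]=⇒lookup y∈)))
    = encode S i , ∈⊤ , S , i , refl , eq

-- Part of the `m`-set is cut into `v` rows, and vertex `a` goes to row `a` at the position given by
-- the codeword. A point thus determines its `a`.
transversal : ∀ k q v {m} → v * (geometric v (suc k) * q) ≤ m → Fin (q ^ suc k) → Fin v → Fin m
transversal k q v le j a = inject≤ (combine a (codeword k q v j a)) le

transversal-injective₂ : ∀ k q v {m} (le : v * (geometric v (suc k) * q) ≤ m) j j' a a' →
  transversal k q v le j a ≡ transversal k q v le j' a' → a ≡ a' × codeword k q v j a ≡ codeword k q v j' a'
transversal-injective₂ k q v le j j' a a' eq =
  combine-injective a (codeword k q v j a) a' (codeword k q v j' a') (inject≤-injective le le _ _ eq)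

-- A common image point lies in a single row, so it comes from the same `a` on both sides and the
-- codewords agree there. Agreement on `suc k` places forces `j ≡ j'`.
transversal-disjoint : ∀ k q v {m n} (le : v * (geometric v (suc k) * q) ≤ m) {ψ : Fin m → Fin n} →
  Injective _≡_ _≡_ ψ → ∀ j j' S S' → ∣ S ∣ ≡ suc k →
  image (ψ ∘ transversal k q v le j) S ≡ image (ψ ∘ transversal k q v le j') S' → j ≡ j'
transversal-disjoint k q v le {ψ} inj j j' S S' card eq = codeword-agree k q j j' S card agree
  where
  agree : ∀ a → a ∈ S → codeword k q v j a ≡ codeword k q v j' a
  agree a a∈S
    with a' , _ , eq' ← ∈-image⁻ (ψ ∘ transversal k q v le j') S'
                          (subst (_ ∈_) eq (∈-image⁺ (ψ ∘ transversal k q v le j) S a a∈S))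
    with refl , eq'' ← transversal-injective₂ k q v le j j' a a' (sym (inj eq')) = eq''

-- The union bound over maps of an m-set

injective? : ∀ {m n} (ψ : Fin m → Fin n) → Dec (∀ a b → ψ a ≡ ψ b → a ≡ b)
injective? ψ = all? λ a → all? λ b → (ψ a ≟ ψ b) →-dec (a ≟ b)

Unavoidable : ∀ {n v} → ℕ → ℕ → Colouring n v → Set
Unavoidable {n} {v} m k g = (ψ : Fin m → Fin n) → Injective _≡_ _≡_ ψ →
  Σ (Fin v → Fin m) λ χ → Injective _≡_ _≡_ χ ×
  Σ (Fin v → Fin n) λ θ → (∀ a → θ a ≡ ψ (χ a)) × Inverts k g θ

unavoidable⇒refuted : ∀ {r k v w n m} {F : Hypergraph (suc v)} {G : Hypergraph w} →
  IsRGraph r F → ¬ ShadowHom k G F → (∃ λ (g : Colouring n (suc v)) → Unavoidable m k g) →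
  ¬ EveryContainsFreeInduced r F G n m
unavoidable⇒refuted {k = k} {F = F} unif ¬hom (g , unavoidable) every
  with ψ , ψ-inj , free ← every (ShadowGraph k F g) (shadowGraph-uniform unif) (shadowGraph-free ¬hom)
  with χ , χ-inj , θ , θ≡ , inv ← unavoidable ψ ψ-inj
  = free (shadowGraph-contains ψ-inj χ-inj θ≡ inv)

-- The union runs over all `n ^ m` maps, with empty patterns for the non-injective ones. Each map
-- has `q ^ suc k` disjoint patterns, of weight at most `suc v ^ N ∸ 1`, so `few` bounds the total
-- potential.
unavoidable-colouring : ∀ k q v m n N → 2 ^ suc v * suc v ≤ N → suc v * (geometric (suc v) (suc k) * q) ≤ m →
  n ^ m * (suc v ^ N ∸ 1) ^ (q ^ suc k) < (suc v ^ N) ^ (q ^ suc k) →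
  ∃ λ (g : Colouring n (suc v)) → Unavoidable m (suc k) g
unavoidable-colouring k q v m n N N≥ le few =
  (λ T x → c (encode T x)) , λ ψ ψ-inj →
    let κ = funToFin ψ
        j , match = matched κ
        decode≗ψ = finToFun-funToFin ψ
        ψ'-inj = λ a b eq → ψ-inj (trans (sym (decode≗ψ a)) (trans eq (decode≗ψ b)))
        χ-inj = λ {a} {b} eq → proj₁ (transversal-injective₂ k q (suc v) le j j a b eq)
        θ = finToFun κ ∘ χ j
    in χ j , χ-inj , θ , (λ a → decode≗ψ (χ j a)) , λ S card i →
       match _ i (invertsPattern-complete (suc k) (injective? (finToFun κ)) θ ψ'-inj
                   (λ eq → χ-inj (ψ'-inj _ _ eq)) S card i)
  where
  χ : Fin (q ^ suc k) → Fin (suc v) → Fin m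
  χ = transversal k q (suc v) le
  pat : Fin (n ^ m) → Fin (q ^ suc k) → Pattern (suc v) (2 ^ n * n)
  pat κ j = invertsPattern (suc k) (injective? (finToFun {n} {m} κ)) (finToFun κ ∘ χ j)
  disjoint : ∀ κ → Disjoint (λ j → just (pat κ j))
  disjoint κ j j' y t t'
    with inj , S , i , card , eq ← invertsPattern-sound (suc k) (injective? (finToFun {n} {m} κ)) (finToFun κ ∘ χ j) y t
       | _ , S' , i' , _ , eq' ← invertsPattern-sound (suc k) (injective? (finToFun {n} {m} κ)) (finToFun κ ∘ χ j') y t'
    = transversal-disjoint k q (suc v) le (λ {a} {b} → inj a b) j j' S S' card
        (proj₁ (encode-injective _ _ _ _ (trans eq (sym eq'))))
  total< : sum (λ κ → potential N (λ j → just (pat κ j))) < (suc v ^ N) ^ (q ^ suc k)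
  total< = begin-strict
    sum (λ κ → potential N (λ j → just (pat κ j)))
      ≤⟨ sum-mono (λ κ → ≤-trans
           (prod-mono (λ j → ∸-monoʳ-≤ (suc v ^ N) (m^n>0 (suc v) (N ∸ size (pat κ j)))))
           (≤-reflexive (prod-const (q ^ suc k) (suc v ^ N ∸ 1)))) ⟩
    sum {n ^ m} (λ _ → (suc v ^ N ∸ 1) ^ (q ^ suc k))
      ≡⟨ sum-const (n ^ m) _ ⟩
    n ^ m * (suc v ^ N ∸ 1) ^ (q ^ suc k)
      <⟨ few ⟩
    (suc v ^ N) ^ (q ^ suc k) ∎
    where open ≤-Reasoning
  coloured = colouring-exists {N = N} (2 ^ n * n) (λ κ j → just (pat κ j))
    (λ κ j → ≤-trans (invertsPattern-size (suc k) (injective? (finToFun {n} {m} κ)) (finToFun κ ∘ χ j)) N≥)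
    disjoint total<
  c = proj₁ coloured
  matched = proj₂ coloured

-- Numerical estimates

n<2^[1+⌊log₂n⌋] : ∀ n → n < 2 ^ suc ⌊log₂ n ⌋
n<2^[1+⌊log₂n⌋] n = ≰⇒> λ le →
  <-irrefl refl (≤-trans (≤-reflexive (sym (⌊log₂[2^n]⌋≡n (suc ⌊log₂ n ⌋)))) (⌊log₂⌋-mono-≤ le))

-- Bernoulli's inequality for `(1 + 1/d) ^ n`, cleared of denominators.
bernoulli : ∀ d n → d ^ n * (d + n) ≤ suc d ^ n * d
bernoulli d zero    = ≤-reflexive (cong (1 *_) (+-identityʳ d))
bernoulli d (suc n) = begin
  d * d ^ n * (d + suc n)             ≤⟨ m≤m+n _ (d ^ n * n) ⟩
  d * d ^ n * (d + suc n) + d ^ n * n ≡⟨ expand d (d ^ n) n ⟩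
  suc d * (d ^ n * (d + n))           ≤⟨ *-monoʳ-≤ (suc d) (bernoulli d n) ⟩
  suc d * (suc d ^ n * d)             ≡⟨ *-assoc (suc d) (suc d ^ n) d ⟨
  suc d * suc d ^ n * d               ∎
  where
  open ≤-Reasoning
  expand : ∀ d x n → d * x * (d + suc n) + x * n ≡ suc d * (x * (d + n))
  expand = solve-∀

2*d^[1+d]≤[1+d]^[1+d] : ∀ d → 2 * d ^ suc d ≤ suc d ^ suc d
2*d^[1+d]≤[1+d]^[1+d] d = begin
  2 * (d * d ^ d)   ≡⟨ rearrange d (d ^ d) ⟩
  d ^ d * (d + d)   ≤⟨ bernoulli d d ⟩
  suc d ^ d * d     ≤⟨ *-monoʳ-≤ (suc d ^ d) (n≤1+n d) ⟩
  suc d ^ d * suc d ≡⟨ *-comm (suc d ^ d) (suc d) ⟩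
  suc d ^ suc d     ∎
  where
  open ≤-Reasoning
  rearrange : ∀ d x → 2 * (d * x) ≡ x * (d + d)
  rearrange = solve-∀

^-distribʳ-* : ∀ s a b → (a * b) ^ s ≡ a ^ s * b ^ s
^-distribʳ-* zero    a b = refl
^-distribʳ-* (suc s) a b = trans (cong (a * b *_) (^-distribʳ-* s a b)) ([m*n]*[o*p]≡[m*o]*[n*p] a b (a ^ s) (b ^ s))

-- Each of `s` blocks of `suc d` factors `d / suc d` contributes at most one half; the `e` remaining
-- factors are at most one.
exponential-gap : ∀ d s t → suc d * s ≤ t → 2 ^ s * d ^ t ≤ suc d ^ t
exponential-gap d s t le = begin
  2 ^ s * d ^ t                             ≡⟨ cong (λ t → 2 ^ s * d ^ t) t≡ ⟨
  2 ^ s * d ^ (suc d * s + e)               ≡⟨ cong (2 ^ s *_) (trans (^-distribˡ-+-* d (suc d * s) e) (cong (_* d ^ e) (sym (^-*-assoc d (suc d) s)))) ⟩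
  2 ^ s * ((d ^ suc d) ^ s * d ^ e)         ≡⟨ *-assoc (2 ^ s) _ _ ⟨
  2 ^ s * (d ^ suc d) ^ s * d ^ e           ≡⟨ cong (_* d ^ e) (^-distribʳ-* s 2 (d ^ suc d)) ⟨
  (2 * d ^ suc d) ^ s * d ^ e               ≤⟨ *-mono-≤ (^-monoˡ-≤ s (2*d^[1+d]≤[1+d]^[1+d] d)) (^-monoˡ-≤ e (n≤1+n d)) ⟩
  (suc d ^ suc d) ^ s * suc d ^ e           ≡⟨ cong (_* suc d ^ e) (^-*-assoc (suc d) (suc d) s) ⟩
  suc d ^ (suc d * s) * suc d ^ e           ≡⟨ ^-distribˡ-+-* (suc d) (suc d * s) e ⟨
  suc d ^ (suc d * s + e)                   ≡⟨ cong (suc d ^_) t≡ ⟩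
  suc d ^ t                                 ∎
  where
  open ≤-Reasoning
  e = t ∸ suc d * s
  t≡ : suc d * s + e ≡ t
  t≡ = m+[n∸m]≡n le

-- Halving `suc L * m` times absorbs `n ^ m`; one further halving makes the inequality strict.
union-bound : ∀ d t L m n → n < 2 ^ suc L → suc d * suc (suc L * m) ≤ t → n ^ m * d ^ t < suc d ^ t
union-bound d t L m n n< le = halve (n ^ m * d ^ t) (begin
  2 * (n ^ m * d ^ t)                 ≤⟨ *-monoʳ-≤ 2 (*-monoˡ-≤ (d ^ t) (^-monoˡ-≤ m (<⇒≤ n<))) ⟩
  2 * ((2 ^ suc L) ^ m * d ^ t)       ≡⟨ cong (λ z → 2 * (z * d ^ t)) (^-*-assoc 2 (suc L) m) ⟩
  2 * (2 ^ (suc L * m) * d ^ t)       ≡⟨ *-assoc 2 (2 ^ (suc L * m)) (d ^ t) ⟨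
  2 ^ suc (suc L * m) * d ^ t         ≤⟨ exponential-gap d (suc (suc L * m)) t le ⟩
  suc d ^ t                           ∎)
  where
  open ≤-Reasoning
  halve : ∀ x → 2 * x ≤ suc d ^ t → x < suc d ^ t
  halve zero    _  = m^n>0 (suc d) t
  halve (suc x) le = <-≤-trans (m<m+n (suc x) (s≤s z≤n)) le

-- The power of `2 * B` pays for rounding in `m ≤ 2 * B * (m / B)`, and the 3 for
-- `suc (suc L * m) ≤ 3 * (L * m)`.
constant : ℕ → ℕ → ℕ → ℕ
constant B D k = (2 * B) ^ suc k * (3 * D)

block-lower : ∀ B k D L m .{{_ : NonZero B}} .{{_ : NonZero D}} → 1 ≤ L → constant B D k * L < m ^ k →
  D * suc (suc L * m) ≤ (m / B) ^ suc k
block-lower B k D L m 1≤L big = *-cancelˡ-≤ ((2 * B) ^ suc k) {{m^n≢0 (2 * B) (suc k) {{m*n≢0 2 B}}}} (begin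
  (2 * B) ^ suc k * (D * suc (suc L * m))     ≤⟨ *-monoʳ-≤ ((2 * B) ^ suc k) (*-monoʳ-≤ D enough) ⟩
  (2 * B) ^ suc k * (D * (3 * (L * m)))       ≡⟨ rearrange ((2 * B) ^ suc k) D L m ⟩
  m * (constant B D k * L)                    ≤⟨ *-monoʳ-≤ m (<⇒≤ big) ⟩
  m ^ suc k                                   ≤⟨ ^-monoˡ-≤ (suc k) m≤2Bq ⟩
  (2 * B * q) ^ suc k                         ≡⟨ ^-distribʳ-* (suc k) (2 * B) q ⟩
  (2 * B) ^ suc k * q ^ suc k                 ∎)
  where
  open ≤-Reasoning
  q = m / B
  rearrange : ∀ x D L m → x * (D * (3 * (L * m))) ≡ m * (x * (3 * D) * L)
  rearrange = solve-∀
  instance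
    L≢0 : NonZero L
    L≢0 = >-nonZero 1≤L
  -- This makes the quotient `q` positive, so rounding down loses at most a factor of two.
  B≤m : B ≤ m
  B≤m = ≮⇒≥ λ m<B → <-irrefl refl (begin-strict
    m ^ k                  ≤⟨ ^-monoˡ-≤ k (<⇒≤ m<B) ⟩
    B ^ k                  ≤⟨ ^-monoˡ-≤ k (m≤n*m B 2) ⟩
    (2 * B) ^ k            ≤⟨ m≤n*m ((2 * B) ^ k) (2 * B) {{m*n≢0 2 B}} ⟩
    (2 * B) ^ suc k        ≤⟨ m≤m*n ((2 * B) ^ suc k) (3 * D) {{m*n≢0 3 D}} ⟩
    constant B D k         ≤⟨ m≤m*n (constant B D k) L ⟩
    constant B D k * L     <⟨ big ⟩
    m ^ k                  ∎)
  1≤q : 1 ≤ q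
  1≤q = m≥n⇒m/n>0 B≤m
  1≤m : 1 ≤ m
  1≤m = ≤-trans (>-nonZero⁻¹ B) B≤m
  m≤2Bq : m ≤ 2 * B * q
  m≤2Bq = begin
    m                     ≡⟨ m≡m%n+[m/n]*n m B ⟩
    m % B + q * B         ≤⟨ +-monoˡ-≤ (q * B) (<⇒≤ (m%n<n m B)) ⟩
    B + q * B             ≤⟨ +-monoˡ-≤ (q * B) (m≤n*m B q {{>-nonZero 1≤q}}) ⟩
    q * B + q * B         ≡⟨ double q B ⟩
    2 * B * q             ∎
    where
    double : ∀ q B → q * B + q * B ≡ 2 * B * q
    double = solve-∀
  enough : suc (suc L * m) ≤ 3 * (L * m)
  enough = begin
    1 + (m + L * m)         ≤⟨ +-mono-≤ (*-mono-≤ 1≤L 1≤m) (+-monoˡ-≤ (L * m) (m≤n*m m L)) ⟩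
    L * m + (L * m + L * m) ≡⟨ triple (L * m) ⟩
    3 * (L * m)             ∎
    where
    triple : ∀ x → x + (x + x) ≡ 3 * x
    triple = solve-∀

few-bad-colourings : ∀ B k D m n .{{_ : NonZero B}} → 1 ≤ D → 2 ≤ n → constant B D k * ⌊log₂ n ⌋ < m ^ k →
  n ^ m * (D ∸ 1) ^ ((m / B) ^ suc k) < D ^ ((m / B) ^ suc k)
few-bad-colourings B k (suc d) m n _ 2≤n big =
  union-bound d ((m / B) ^ suc k) ⌊log₂ n ⌋ m n (n<2^[1+⌊log₂n⌋] n)
    (block-lower B k (suc d) ⌊log₂ n ⌋ m (⌊log₂⌋-mono-≤ 2≤n) big)

blocks-fit : ∀ a b B m .{{_ : NonZero B}} → a * b ≤ B → a * (b * (m / B)) ≤ m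
blocks-fit a b B m ab≤B = begin
  a * (b * (m / B)) ≡⟨ *-assoc a b (m / B) ⟨
  a * b * (m / B)   ≤⟨ *-monoˡ-≤ (m / B) ab≤B ⟩
  B * (m / B)       ≡⟨ *-comm B (m / B) ⟩
  m / B * B         ≤⟨ m/n*n≤m m B ⟩
  m                 ∎
  where open ≤-Reasoning

-- Assembling the bound

large-m-refuted : ∀ {r k v w} {F : Hypergraph (suc v)} {G : Hypergraph w} {n m} N B .{{_ : NonZero B}} →
  2 ^ suc v * suc v ≤ N → suc v * geometric (suc v) (suc k) ≤ B →
  IsRGraph r F → ¬ ShadowHom (suc k) G F → 2 ≤ n →
  constant B (suc v ^ N) k * ⌊log₂ n ⌋ < m ^ k →
  ¬ EveryContainsFreeInduced r F G n m
large-m-refuted {r} {k} {v} {w} {F} {G} {n} {m} N B N≥ B≥ unif ¬hom 2≤n big every =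
  unavoidable⇒refuted unif ¬hom
    (unavoidable-colouring k (m / B) v m n N N≥
      (blocks-fit (suc v) (geometric (suc v) (suc k)) B m B≥)
      (few-bad-colourings B k (suc v ^ N) m n (m^n>0 (suc v) N) 2≤n big))
    every

-- Such an `F` has no edges, so every hypergraph contains it. The edgeless host is `G`-free, since a
-- copy of `G` would make `G` edgeless and hence trivially shadow-homomorphic to `F`.
null-graph-refuted : ∀ {r k w} {F : Hypergraph 0} {G : Hypergraph w} {n m} → 1 ≤ r →
  IsRGraph r F → ¬ ShadowHom k G F → ¬ EveryContainsFreeInduced r F G n m
null-graph-refuted {F = F} 1≤r unif ¬hom every =
  let ψ , _ , free = every (λ _ → ⊥) (λ _ ()) empty-free
  in free ((λ ()) , (λ {i} → contradiction i λ ()) , λ e Fe → contradiction Fe (no-edge e))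
  where
  no-edge : ∀ e → ¬ F e
  no-edge [] Fe = contradiction (subst (1 ≤_) (sym (unif [] Fe)) 1≤r) λ ()
  empty-free : Free _ (λ _ → ⊥)
  empty-free (φ , _ , emb) = ¬hom
    ( (λ S p → contradiction (edgeless p) λ ()) , (λ S p → contradiction (edgeless p) λ ())
    , (λ S p → contradiction (edgeless p) λ ()) , λ e Ge → contradiction (proj₂ (proj₂ (emb e Ge))) λ ())
    where
    edgeless : ∀ {S} → InShadow _ _ S → ⊥
    edgeless (_ , e , Ge , _) = proj₂ (proj₂ (emb e Ge))

theorem1p7 : (r k : ℕ) → 2 ≤ k → k < r →
    {vF : ℕ} (F : Hypergraph vF) → IsRGraph r F →
    Σ ℕ λ C →
    {vG : ℕ} (G : Hypergraph vG) → IsRGraph r G → ¬ ShadowHom k G F →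
    Σ ℕ λ n₀ → (n : ℕ) → n₀ ≤ n →
    (m : ℕ) → EveryContainsFreeInduced r F G n m →
    m ^ (k ∸ 1) ≤ C * ⌊log₂ n ⌋
theorem1p7 r zero    ()  k<r F unif
theorem1p7 r (suc k) 2≤k k<r {zero} F unif = 0 , λ G _ ¬hom → 0 , λ n _ m every →
  contradiction every (null-graph-refuted (≤-trans (s≤s z≤n) k<r) unif ¬hom)
theorem1p7 r (suc k) 2≤k k<r {suc v} F unif =
  -- The constant involves only `k` and the number of vertices of `F`. The threshold 2 makes the
  -- logarithm at least 1.
  constant (suc v * geometric (suc v) (suc k)) (suc v ^ (2 ^ suc v * suc v)) k , λ G _ ¬hom → 2 , λ n 2≤n m every →
    ≮⇒≥ λ big → large-m-refuted (2 ^ suc v * suc v) (suc v * geometric (suc v) (suc k)) ≤-refl ≤-refl unif ¬hom 2≤n big every
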